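{- The operator $h\mapsto h^i$ is a bijection from the set of hypergraph Horn functions on $V$ to itself; hence every hypergraph Horn function on $V$ is the implicate-dual of some hypergraph Horn function on $V$.
   Context: $V$ is a finite set of Boolean variables. A Boolean function on $V$ is a map $f:2^V\to\{0,1\}$; its true sets are the sets $Z\subseteq V$ with $f(Z)=1$, and $\mathcal{T}(f)$ is the family of true sets. Write $f\le g$ if $f(X)\le g(X)$ for all $X\subseteq V$. For $B\subsetneq V$ and $v\in V\setminus B$, the definite Horn clause $B\to v$ is the Boolean function whose true sets are the sets $T$ with $B\not\subseteq T$ or $B\cup\{v\}\subseteq T$. It is an implicate of $f$ if $f\le (B\to v)$. For a hypergraph $\mathcal{H}\subseteq 2^V$ let $\Phi_{\mathcal{H}}=\bigwedge_{H\in\mathcal{H}}\bigwedge_{v\in H}((H\setminus\{v\})\to v)$ (the empty conjunction is the constant $1$). A Boolean function is hypergraph Horn if it equals $\Phi_{\mathcal{H}}$ for some hypergraph $\mathcal{H}\subseteq 2^V$. A set $I\subseteq V$ is an implicate set of $f$ if $(I\setminus\{v\})\to v$ is an implicate of $f$ for all $v\in I$; $\mathcal{I}(f)$ is the family of implicate sets. The implicate-dual $f^i$ of a Boolean function $f$ is the Boolean function defined by $\mathcal{T}(f^i)=\{V\setminus I\mid I\in\mathcal{I}(f)\}$. -}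

module Defs where

open import Data.Bool.Base using (Bool; true; _≤_)
import Data.Bool.Properties as Bool
open import Data.Fin.Base using (Fin)
open import Data.Fin.Properties using (all?)
open import Data.Fin.Subset using (Subset; _∈_; _⊆_; _⊈_; _∪_; _-_; ⁅_⁆; ∁)
open import Data.Fin.Subset.Properties using (_∈?_; _⊆?_; anySubset?)
open import Data.Nat.Base using (ℕ)
open import Data.Product.Base using (Σ; ∃; _×_; _,_; proj₁)
open import Data.Sum.Base using (_⊎_)
open import Data.Vec.Properties using (≡-dec)
open import Function.Base using (_∘_)
open import Function.Bundles using (_⇔_; mk⇔)
open import Relation.Binary.PropositionalEquality using (_≡_; refl; _≗_)
open import Relation.Nullary.Decidable
  using (Dec; yes; does; dec-true; map′; ¬?; _×-dec_; _⊎-dec_; _→-dec_; decidable-stable)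

private
  variable
    n : ℕ

allSubset? : {P : Subset n → Set} → (∀ X → Dec (P X)) → Dec (∀ X → P X)
allSubset? P? =
  map′ (λ ¬∃ X → decidable-stable (P? X) (λ ¬p → ¬∃ (X , ¬p)))
       (λ { ∀P (X , ¬p) → ¬p (∀P X) })
       (¬? (anySubset? (¬? ∘ P?)))

does-true⇔ : {A : Set} (a? : Dec A) → does a? ≡ true ⇔ A
does-true⇔ a? = mk⇔ (to a?) (dec-true a?)
  where
  to : {A : Set} (a? : Dec A) → does a? ≡ true → A
  to (yes a) refl = a

-- The finite set V of variables is Fin n.  Boolean functions are compared
-- pointwise (_≗_), since function extensionality is not available.

BoolFun : ℕ → Set
BoolFun n = Subset n → Bool

TrueSet : BoolFun n → Subset n → Set
TrueSet f X = f X ≡ true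

infix 4 _≤ᶠ_

_≤ᶠ_ : BoolFun n → BoolFun n → Set
f ≤ᶠ g = ∀ X → f X ≤ g X

-- B ⟶ v is only meant for v ∉ B (whence B ≠ V).  In Φ and ImplicateSet it occurs
-- with B = H - v, where this holds.

infix 5 _⟶_

clause? : (B : Subset n) (v : Fin n) (T : Subset n) → Dec (B ⊈ T ⊎ (B ∪ ⁅ v ⁆) ⊆ T)
clause? B v T = ¬? (B ⊆? T) ⊎-dec (B ∪ ⁅ v ⁆) ⊆? T

_⟶_ : Subset n → Fin n → BoolFun n
(B ⟶ v) T = does (clause? B v T)

⟶-trueSet : (B : Subset n) (v : Fin n) (T : Subset n) →
            TrueSet (B ⟶ v) T ⇔ (B ⊈ T ⊎ (B ∪ ⁅ v ⁆) ⊆ T)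
⟶-trueSet B v T = does-true⇔ (clause? B v T)

Implicate : BoolFun n → Subset n → Fin n → Set
Implicate f B v = f ≤ᶠ (B ⟶ v)

-- A family of subsets of V, given by its characteristic function; the empty
-- family and the empty hyperedge are both allowed.

Hypergraph : ℕ → Set
Hypergraph n = Subset n → Bool

infix 4 _∈ᴴ_

_∈ᴴ_ : Subset n → Hypergraph n → Set
H ∈ᴴ ℋ = ℋ H ≡ true

Φ? : (ℋ : Hypergraph n) (X : Subset n) →
     Dec (∀ H → H ∈ᴴ ℋ → ∀ v → v ∈ H → TrueSet ((H - v) ⟶ v) X)
Φ? ℋ X = allSubset? λ H → (ℋ H Bool.≟ true) →-dec
  all? λ v → (v ∈? H) →-dec (((H - v) ⟶ v) X Bool.≟ true)

Φ : Hypergraph n → BoolFun n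
Φ ℋ X = does (Φ? ℋ X)

Φ-trueSet : (ℋ : Hypergraph n) (X : Subset n) →
            TrueSet (Φ ℋ) X ⇔
            (∀ H → H ∈ᴴ ℋ → ∀ v → v ∈ H → TrueSet ((H - v) ⟶ v) X)
Φ-trueSet ℋ X = does-true⇔ (Φ? ℋ X)

IsHypergraphHorn : BoolFun n → Set
IsHypergraphHorn f = ∃ λ ℋ → f ≗ Φ ℋ

-- The witnessing hypergraph is not unique and is ignored by the equality _≈_.

HypergraphHorn : ℕ → Set
HypergraphHorn n = Σ (BoolFun n) IsHypergraphHorn

infix 4 _≈_

_≈_ : HypergraphHorn n → HypergraphHorn n → Set
h ≈ g = proj₁ h ≗ proj₁ g

ImplicateSet : BoolFun n → Subset n → Set
ImplicateSet f I = ∀ v → v ∈ I → Implicate f (I - v) v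

implicateSet? : (f : BoolFun n) → ∀ I → Dec (ImplicateSet f I)
implicateSet? f I = all? λ v → (v ∈? I) →-dec
  allSubset? λ X → f X Bool.≤? ((I - v) ⟶ v) X

dual? : (f : BoolFun n) (X : Subset n) → Dec (∃ λ I → ImplicateSet f I × X ≡ ∁ I)
dual? f X = anySubset? λ I → implicateSet? f I ×-dec ≡-dec Bool._≟_ X (∁ I)

infix 8 _ⁱ

_ⁱ : BoolFun n → BoolFun n
(f ⁱ) X = does (dual? f X)

ⁱ-trueSet : (f : BoolFun n) (X : Subset n) →
            TrueSet (f ⁱ) X ⇔ (∃ λ I → ImplicateSet f I × X ≡ ∁ I)
ⁱ-trueSet f X = does-true⇔ (dual? f X)

{-# OPTIONS --safe #-}

-- The clause (H ∖ v) → v fails on X exactly when H ∩ (V ∖ X) = {v}.  Hence both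
-- Φ and the implicate-dual are polarities of the symmetric relation |A ∩ B| ≠ 1,
-- up to complementation, and Φ ℋ is the dual of ℋ ∘ ∁.  The hypergraph Horn
-- functions are thus the closed elements of an antitone Galois connection of ⁱ
-- with itself, on which ⁱ is an involution.
module Submission where

open import Defs
open import Algebra.Lattice.Properties.BooleanAlgebra using (¬-involutive)
open import Data.Bool.Base using (Bool; true; false; _≤_; b≤b)
open import Data.Bool.Properties using (⇔→≡; ≤-minimum)
open import Data.Fin.Base using (Fin)
open import Data.Fin.Properties using (_≟_)
open import Data.Fin.Subset using (Subset; _∈_; _∉_; _⊆_; _⊈_; _∪_; _-_; ⁅_⁆; ∁)
open import Data.Fin.Subset.Properties
  using (∪-∩-booleanAlgebra; ⊂-irref; x∈∁p⇒x∉p; x∉∁p⇒x∈p; x∉p⇒x∈∁p; x∈⁅x⁆;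
         x∈⁅y⁆⇒x≡y; x∈p∪q⁺; x∈p∪q⁻; x∈p∧x≢y⇒x∈p-y; x∈p⇒p-x⊂p; p─q⊆p; p─q─q≡p─q;
         _∈?_; _⊆?_)
open import Data.Nat.Base using (ℕ)
open import Data.Product.Base using (Σ; ∃; _×_; _,_)
open import Data.Sum.Base using (_⊎_; inj₁; inj₂; [_,_]′)
open import Function.Base using (_∘_)
open import Function.Bundles using (_⇔_; mk⇔; Equivalence)
open import Function.Structures using (IsBijection)
open import Relation.Binary.PropositionalEquality
  using (_≡_; refl; sym; trans; cong; subst; _≗_)
open import Relation.Binary.Structures using (IsEquivalence)
open import Relation.Nullary using (¬_; yes; no; contradiction)
open import Relation.Nullary.Decidable using (decidable-stable)

open Equivalence using (to; from)

private
  variable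
    n : ℕ
    A B : Subset n

∁-involutive : (X : Subset n) → ∁ (∁ X) ≡ X
∁-involutive {n} = ¬-involutive (∪-∩-booleanAlgebra n)

-- Deleting `x` a second time changes nothing, whereas deleting an element that is present gives a
-- strictly smaller set.
x∉p-x : (p : Subset n) (x : Fin n) → x ∉ p - x
x∉p-x p x x∈p-x = ⊂-irref (p─q─q≡p─q p ⁅ x ⁆) (x∈p⇒p-x⊂p x∈p-x)

≤⇔true⇒true : {x y : Bool} → x ≤ y ⇔ (x ≡ true → y ≡ true)
≤⇔true⇒true = mk⇔ (λ { b≤b x≡true → x≡true }) true⇒true→≤
  where
  true⇒true→≤ : {x y : Bool} → (x ≡ true → y ≡ true) → x ≤ y
  true⇒true→≤ {false} {y} _ = ≤-minimum y
  true⇒true→≤ {true} imp with refl ← imp refl = b≤b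

-- |A ∩ B| ≠ 1.
Orthogonal : Subset n → Subset n → Set
Orthogonal A B = ∀ v → v ∈ A → v ∈ B → ¬ (∀ w → w ∈ A → w ∈ B → w ≡ v)

Orthogonal-sym : Orthogonal A B → Orthogonal B A
Orthogonal-sym A⊥B v v∈B v∈A unique =
  A⊥B v v∈A v∈B λ w w∈A w∈B → unique w w∈B w∈A

clauses⇔Orthogonal : (H X : Subset n) →
  (∀ v → v ∈ H → TrueSet ((H - v) ⟶ v) X) ⇔ Orthogonal H (∁ X)
clauses⇔Orthogonal H X = mk⇔ clauses⇒⊥ ⊥⇒clauses
  where
  clauses⇒⊥ : (∀ v → v ∈ H → TrueSet ((H - v) ⟶ v) X) → Orthogonal H (∁ X)
  clauses⇒⊥ clauses v v∈H v∈∁X unique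
    with to (⟶-trueSet (H - v) v X) (clauses v v∈H)
  ... | inj₂ ⊆X = x∈∁p⇒x∉p v∈∁X (⊆X (x∈p∪q⁺ (inj₂ (x∈⁅x⁆ v))))
  -- An element of `H - v` outside `X` would equal `v` by uniqueness, so `H - v` lies inside `X`
  -- after all.
  ... | inj₁ H-v⊈X = H-v⊈X λ {w} w∈H-v → x∉∁p⇒x∈p λ w∈∁X →
    x∉p-x H v (subst (_∈ H - v) (unique w (p─q⊆p H ⁅ v ⁆ w∈H-v) w∈∁X) w∈H-v)

  ⊥⇒clauses : Orthogonal H (∁ X) → ∀ v → v ∈ H → TrueSet ((H - v) ⟶ v) X
  ⊥⇒clauses H⊥∁X v v∈H = from (⟶-trueSet (H - v) v X) clause
    where
    clause : H - v ⊈ X ⊎ ((H - v) ∪ ⁅ v ⁆) ⊆ X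
    clause with (H - v) ⊆? X | v ∈? X
    ... | no H-v⊈X | _ = inj₁ H-v⊈X
    ... | yes H-v⊆X | yes v∈X = inj₂ λ w∈H →
      [ H-v⊆X , (λ w∈⁅v⁆ → subst (_∈ X) (sym (x∈⁅y⁆⇒x≡y v w∈⁅v⁆)) v∈X) ]′
        (x∈p∪q⁻ (H - v) ⁅ v ⁆ w∈H)
    -- The only falsifying case: `v` is then the sole element of `H` outside `X`.
    ... | yes H-v⊆X | no v∉X = contradiction
      (λ w w∈H w∈∁X → decidable-stable (w ≟ v) λ w≢v →
        x∈∁p⇒x∉p w∈∁X (H-v⊆X (x∈p∧x≢y⇒x∈p-y w∈H w≢v)))
      (H⊥∁X v v∈H (x∉p⇒x∈∁p v∉X))

Φ⇔Orthogonal : (ℋ : Hypergraph n) (X : Subset n) →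
  TrueSet (Φ ℋ) X ⇔ (∀ H → H ∈ᴴ ℋ → Orthogonal H (∁ X))
Φ⇔Orthogonal ℋ X = mk⇔
  (λ X∈Φ H H∈ℋ → to (clauses⇔Orthogonal H X) (to (Φ-trueSet ℋ X) X∈Φ H H∈ℋ))
  (λ ℋ⊥∁X → from (Φ-trueSet ℋ X) λ H H∈ℋ →
    from (clauses⇔Orthogonal H X) (ℋ⊥∁X H H∈ℋ))

-- Exchanging the quantifiers over `v` and `X` groups the clauses of `I` at each true set `X`, where
-- `clauses⇔Orthogonal` applies.
ImplicateSet⇔Orthogonal : (f : BoolFun n) (I : Subset n) →
  ImplicateSet f I ⇔ (∀ X → TrueSet f X → Orthogonal I (∁ X))
ImplicateSet⇔Orthogonal f I = mk⇔
  (λ implicate X fX → to (clauses⇔Orthogonal I X) λ v v∈I →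
    to ≤⇔true⇒true (implicate v v∈I X) fX)
  (λ I⊥ v v∈I X → from ≤⇔true⇒true λ fX →
    from (clauses⇔Orthogonal I X) (I⊥ X fX) v v∈I)

-- Complementation is an involution, so the implicate set witnessing `X` can only be `∁ X`, and the
-- existential disappears.
ⁱ⇔Orthogonal : (f : BoolFun n) (X : Subset n) →
  TrueSet (f ⁱ) X ⇔ (∀ Y → TrueSet f Y → Orthogonal (∁ X) (∁ Y))
ⁱ⇔Orthogonal f X = mk⇔ ⁱ⇒⊥ λ ∁X⊥ → from (ⁱ-trueSet f X)
  (∁ X , from (ImplicateSet⇔Orthogonal f (∁ X)) ∁X⊥ , sym (∁-involutive X))
  where
  ⁱ⇒⊥ : TrueSet (f ⁱ) X → ∀ Y → TrueSet f Y → Orthogonal (∁ X) (∁ Y)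
  ⁱ⇒⊥ fⁱX with I , implicate , refl ← to (ⁱ-trueSet f X) fⁱX
    rewrite ∁-involutive I = to (ImplicateSet⇔Orthogonal f I) implicate

ⁱ-antitone : (f g : BoolFun n) → (∀ X → TrueSet f X → TrueSet g X) →
             ∀ X → TrueSet (g ⁱ) X → TrueSet (f ⁱ) X
ⁱ-antitone f g f⊆g X gⁱX = from (ⁱ⇔Orthogonal f X) λ Y fY →
  to (ⁱ⇔Orthogonal g X) gⁱX Y (f⊆g Y fY)

-- This is where symmetry of orthogonality enters: it makes `ⁱ` its own partner in the Galois
-- connection.
ⁱⁱ-extensive : (f : BoolFun n) → ∀ X → TrueSet f X → TrueSet (f ⁱ ⁱ) X
ⁱⁱ-extensive f X fX = from (ⁱ⇔Orthogonal (f ⁱ) X) λ Y fⁱY →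
  Orthogonal-sym (to (ⁱ⇔Orthogonal f Y) fⁱY X fX)

ⁱ-cong : (f g : BoolFun n) → f ≗ g → f ⁱ ≗ g ⁱ
ⁱ-cong f g f≗g X = ⇔→≡ (mk⇔
  (ⁱ-antitone g f (λ Y → trans (f≗g Y)) X)
  (ⁱ-antitone f g (λ Y → trans (sym (f≗g Y))) X))

-- One inclusion dualises extensivity at `f`; the other is extensivity at `f ⁱ`.
ⁱⁱⁱ≗ⁱ : (f : BoolFun n) → f ⁱ ⁱ ⁱ ≗ f ⁱ
ⁱⁱⁱ≗ⁱ f X = ⇔→≡ (mk⇔
  (ⁱ-antitone f (f ⁱ ⁱ) (ⁱⁱ-extensive f) X)
  (ⁱⁱ-extensive (f ⁱ) X))

-- The true sets of `ℋ ∘ ∁` are the complements of hyperedges, so both sides require `∁ X` to be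
-- orthogonal to every hyperedge.
Φ≗[∘∁]ⁱ : (ℋ : Hypergraph n) → Φ ℋ ≗ (ℋ ∘ ∁) ⁱ
Φ≗[∘∁]ⁱ ℋ X = ⇔→≡ (mk⇔
  (λ ΦX → from (ⁱ⇔Orthogonal (ℋ ∘ ∁) X) λ Y ∁Y∈ℋ →
    Orthogonal-sym (to (Φ⇔Orthogonal ℋ X) ΦX (∁ Y) ∁Y∈ℋ))
  (λ ⁱX → from (Φ⇔Orthogonal ℋ X) λ H H∈ℋ →
    Orthogonal-sym (subst (Orthogonal (∁ X)) (∁-involutive H)
      (to (ⁱ⇔Orthogonal (ℋ ∘ ∁) X) ⁱX (∁ H)
        (trans (cong ℋ (∁-involutive H)) H∈ℋ)))))

ⁱ-isHypergraphHorn : (f : BoolFun n) → IsHypergraphHorn (f ⁱ)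
-- The hyperedges are the complements of the true sets of `f`; complementing twice restores `f`.
ⁱ-isHypergraphHorn f = f ∘ ∁ , λ X → sym
  (trans (Φ≗[∘∁]ⁱ (f ∘ ∁) X) (ⁱ-cong (f ∘ ∁ ∘ ∁) f (cong f ∘ ∁-involutive) X))

-- A hypergraph Horn function is itself a dual `g ⁱ`, so its double dual is a triple dual of `g` and
-- collapses.
ⁱ-involutive : (f : BoolFun n) → IsHypergraphHorn f → f ⁱ ⁱ ≗ f
ⁱ-involutive f (ℋ , f≗Φℋ) X =
  trans (ⁱ-cong (f ⁱ) (g ⁱ ⁱ) (ⁱ-cong f (g ⁱ) f≗gⁱ) X) (trans (ⁱⁱⁱ≗ⁱ g X) (sym (f≗gⁱ X)))
  where
  g : BoolFun _
  g = ℋ ∘ ∁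

  f≗gⁱ : f ≗ g ⁱ
  f≗gⁱ Y = trans (f≗Φℋ Y) (Φ≗[∘∁]ⁱ ℋ Y)

≈-isEquivalence : IsEquivalence (_≈_ {n})
≈-isEquivalence = record
  { refl  = λ X → refl
  ; sym   = λ h≈g X → sym (h≈g X)
  ; trans = λ h≈g g≈k X → trans (h≈g X) (g≈k X)
  }

corollary19 : (n : ℕ) →
    (Σ ((h : BoolFun n) → IsHypergraphHorn h → IsHypergraphHorn (h ⁱ)) λ closed →
       IsBijection (_≈_ {n}) (_≈_ {n}) (λ (h , hornʰ) → (h ⁱ , closed h hornʰ)))
    × ((h : BoolFun n) → IsHypergraphHorn h →
         ∃ λ (g : BoolFun n) → IsHypergraphHorn g × (h ≗ (g ⁱ)))
corollary19 n =
  ( (λ h _ → ⁱ-isHypergraphHorn h)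
  , record
    { isInjection = record
      { isCongruent = record
        { cong           = λ { {h , _} {g , _} → ⁱ-cong h g }
        ; isEquivalence₁ = ≈-isEquivalence
        ; isEquivalence₂ = ≈-isEquivalence
        }
      ; injective = λ { {h , hornʰ} {g , hornᵍ} hⁱ≗gⁱ X →
          trans (sym (ⁱ-involutive h hornʰ X))
                (trans (ⁱ-cong (h ⁱ) (g ⁱ) hⁱ≗gⁱ X) (ⁱ-involutive g hornᵍ X)) }
      }
    -- The preimage of `h` is `h ⁱ`; surjectivity over a setoid also asks that everything `≈`-equal
    -- to it be sent to `h`, hence `ⁱ-cong`.
    ; surjective = λ (h , hornʰ) → (h ⁱ , ⁱ-isHypergraphHorn h) ,
        λ { {g , _} g≗hⁱ X → trans (ⁱ-cong g (h ⁱ) g≗hⁱ X) (ⁱ-involutive h hornʰ X) }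
    }
  )
  , λ h hornʰ → h ⁱ , ⁱ-isHypergraphHorn h , λ X → sym (ⁱ-involutive h hornʰ X)
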